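{- Let $b$ and $c$ be positive integers such that $b$ is odd and $c$ is even. Then there is an integer $n$ with $1 < n \leq \max\{b,c\}$ such that $n^2 + bn + c$ is a practical number.
   Context: A positive integer $N$ is called a practical number if every positive integer less than or equal to $N$ can be expressed as a sum of distinct positive divisors of $N$. -}

module Defs where

open import Data.Nat using (ℕ; _≤_; _<_)
open import Data.Nat.Divisibility using (_∣_)
open import Data.Nat.ListAction using (sum)
open import Data.List.Relation.Unary.All using (All)
open import Data.List.Relation.Unary.Unique.Propositional using (Unique)
open import Data.Product using (_×_; ∃-syntax)
open import Relation.Binary.PropositionalEquality using (_≡_)

IsSumOfDistinctDivisors : ℕ → ℕ → Set
IsSumOfDistinctDivisors N m =
  ∃[ ds ] Unique ds × All (λ d → 0 < d × d ∣ N) ds × sum ds ≡ m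

Practical : ℕ → Set
Practical N = 0 < N × (∀ m → 0 < m → m ≤ N → IsSumOfDistinctDivisors N m)

{-# OPTIONS --safe #-}
-- If q ≤ 2^(k+1) then 2^k * q is practical: for odd q write m = a * q + r and
-- expand a and r in binary.  Since b is odd, n² + bn + c has derivative 2n + b
-- odd, so it has an even root modulo every K = 2^k, and n ↦ -b - n exchanges
-- its two roots.  Taking K ≤ max(b, c) < 2K, one of the roots n satisfies
-- n² + bn + c ≤ 2K², except when c = K and b ≡ -1 (mod K), where n = K works.
module Submission where

open import Defs
open import Data.Empty using (⊥)
open import Data.Nat using
  (ℕ; _+_; _*_; _^_; _<_; _≤_; _⊔_; zero; suc; z≤n; s≤s; z<s; NonZero; >-nonZero)
open import Data.Nat.Divisibility using
  (_∣_; _∤_; divides; m∣m*n; ∣-trans; ∣m+n∣m⇒∣n; ∣m∣n⇒∣m+n; *-monoʳ-∣; ∣n⇒∣m*n; ∣-refl; ∣⇒≤)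
open import Data.Nat.DivMod using (_/_; _%_; m*n/n≡m; /-monoˡ-≤; m≡m%n+[m/n]*n; m%n<n)
open import Data.Nat.Induction using (<-rec)
open import Data.Nat.ListAction using (sum)
open import Data.Nat.ListAction.Properties using (sum-++)
open import Data.Nat.Logarithm using (⌊log₂_⌋; ⌊log₂[2^n]⌋≡n)
open import Data.Nat.Properties
open import Data.Nat.Tactic.RingSolver using (solve-∀)
open import Data.List using (List; []; _∷_; map; _++_)
open import Data.List.Membership.Propositional using (_∈_)
open import Data.List.Membership.Propositional.Properties using (∈-map⁻)
open import Data.List.Relation.Unary.All as All using (All; []; _∷_)
import Data.List.Relation.Unary.All.Properties as All
open import Data.List.Relation.Unary.AllPairs using ([]; _∷_)
open import Data.List.Relation.Unary.Unique.Propositional using (Unique)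
import Data.List.Relation.Unary.Unique.Propositional.Properties as Unique
open import Data.Product using (_×_; ∃-syntax; _,_)
open import Data.Sum using (_⊎_; inj₁; inj₂)
open import Relation.Binary.PropositionalEquality
open import Relation.Nullary using (yes; no; contradiction)

-- Parity and binary expansions

parity-split : ∀ n → (∃[ h ] n ≡ 2 * h) ⊎ (∃[ h ] n ≡ 1 + 2 * h)
parity-split zero = inj₁ (0 , refl)
parity-split (suc n) with parity-split n
... | inj₁ (h , refl) = inj₂ (h , refl)
... | inj₂ (h , refl) = inj₁ (suc h , sym (*-suc 2 h))

odd⇒1+2* : ∀ n → 2 ∤ n → ∃[ h ] n ≡ 1 + 2 * h
odd⇒1+2* n 2∤n with parity-split n
... | inj₁ (h , refl) = contradiction (m∣m*n h) 2∤n
... | inj₂ odd = odd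

2^-injective : ∀ {i j} → 2 ^ i ≡ 2 ^ j → i ≡ j
2^-injective {i} {j} eq =
  trans (sym (⌊log₂[2^n]⌋≡n i)) (trans (cong ⌊log₂_⌋ eq) (⌊log₂[2^n]⌋≡n j))

2^>0 : ∀ k → 0 < 2 ^ k
2^>0 = m^n>0 2

-- The top bit is split off whenever it fits. Exponents are listed instead of powers, so that an
-- expansion can be mapped to `2 ^ e` or to `q * 2 ^ e`; the bound on them makes each new exponent
-- `k` fresh.
binary-expansion : ∀ k a → a < 2 ^ k →
  ∃[ es ] Unique es × All (_< k) es × sum (map (2 ^_) es) ≡ a
binary-expansion zero zero _ = [] , [] , [] , refl
binary-expansion zero (suc _) (s≤s ())
binary-expansion (suc k) a a< with a <? 2 ^ k
... | yes a<2^k with es , uniq , es<k , eq ← binary-expansion k a a<2^k =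
  es , uniq , All.map m<n⇒m<1+n es<k , eq
... | no a≮2^k
  with r , refl ← m≤n⇒∃[o]m+o≡n (≮⇒≥ a≮2^k)
  with es , uniq , es<k , eq ← binary-expansion k r
    (subst (r <_) (+-identityʳ (2 ^ k)) (+-cancelˡ-< (2 ^ k) _ _ a<)) =
  k ∷ es , All.map (λ e<k k≡e → <⇒≢ e<k (sym k≡e)) es<k ∷ uniq ,
  n<1+n k ∷ All.map m<n⇒m<1+n es<k , cong (2 ^ k +_) eq

-- Practicality of `2 ^ k * q`

odd*2^≡2^⇒≡1 : ∀ q → 2 ∤ q → ∀ i j → q * 2 ^ i ≡ 2 ^ j → q ≡ 1
odd*2^≡2^⇒≡1 q odd zero zero eq = trans (sym (*-identityʳ q)) eq
odd*2^≡2^⇒≡1 q odd zero (suc j) eq =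
  contradiction (subst (2 ∣_) (trans (sym eq) (*-identityʳ q)) (m∣m*n (2 ^ j))) odd
odd*2^≡2^⇒≡1 q odd (suc i) zero eq =
  contradiction (m*n≡1⇒n≡1 q (2 * 2 ^ i) eq)
    (λ e → contradiction (m*n≡1⇒m≡1 2 (2 ^ i) e) λ ())
odd*2^≡2^⇒≡1 q odd (suc i) (suc j) eq =
  odd*2^≡2^⇒≡1 q odd i j (*-cancelˡ-≡ _ _ 2 (trans (swap q (2 ^ i)) eq))
  where
  swap : ∀ x y → 2 * (x * y) ≡ x * (2 * y)
  swap = solve-∀

sum-map-* : ∀ q es → sum (map (λ e → q * 2 ^ e) es) ≡ q * sum (map (2 ^_) es)
sum-map-* q [] = sym (*-zeroʳ q)
sum-map-* q (e ∷ es) = trans (cong (q * 2 ^ e +_) (sum-map-* q es))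
                             (sym (*-distribˡ-+ q (2 ^ e) _))

2^-monoʳ-∣ : ∀ {e k} → e ≤ k → 2 ^ e ∣ 2 ^ k
2^-monoʳ-∣ {e} {k} e≤k with o , refl ← m≤n⇒∃[o]m+o≡n e≤k =
  subst (2 ^ e ∣_) (sym (^-distribˡ-+-* 2 e o)) (m∣m*n (2 ^ o))

-- The divisors are `q * 2 ^ e` for the bits of `a` and `2 ^ e` for the bits of `r`, with `e ≤ k`.
-- The two families are disjoint because an odd `q` other than 1 divides no power of two.
sum-of-divisors : ∀ k q → 2 ∤ q → q ≢ 1 → 0 < q → ∀ a r →
  a < 2 ^ suc k → r < 2 ^ suc k → IsSumOfDistinctDivisors (2 ^ k * q) (q * a + r)
sum-of-divisors k q odd q≢1 q>0 a r a< r<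
  with as , as! , as≤k , refl ← binary-expansion (suc k) a a<
  with rs , rs! , rs≤k , refl ← binary-expansion (suc k) r r< =
  map (λ e → q * 2 ^ e) as ++ map (2 ^_) rs ,
  Unique.++⁺
    (Unique.map⁺ (λ eq → 2^-injective (*-cancelˡ-≡ _ _ q eq)) as!)
    (Unique.map⁺ 2^-injective rs!)
    (λ { (x∈ , y∈) → disjoint (∈-map⁻ _ x∈) (∈-map⁻ _ y∈) }) ,
  All.++⁺
    (All.map⁺ (All.map (λ { {e} (s≤s e≤k) → *-mono-≤ q>0 (2^>0 e) ,
      subst (q * 2 ^ e ∣_) (*-comm q (2 ^ k)) (*-monoʳ-∣ q (2^-monoʳ-∣ e≤k)) }) as≤k))
    (All.map⁺ (All.map (λ { {e} (s≤s e≤k) → 2^>0 e ,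
      ∣-trans (2^-monoʳ-∣ e≤k) (m∣m*n q) }) rs≤k)) ,
  trans (sum-++ (map (λ e → q * 2 ^ e) as) _) (cong (_+ _) (sum-map-* q as))
  where
  instance
    q≢0 : NonZero q
    q≢0 = >-nonZero q>0
  disjoint : ∀ {x as rs} → ∃[ i ] i ∈ as × x ≡ q * 2 ^ i → ∃[ j ] j ∈ rs × x ≡ 2 ^ j → ⊥
  disjoint (i , _ , refl) (j , _ , eq) = q≢1 (odd*2^≡2^⇒≡1 q odd i j eq)

-- Covers `q = 1`, where the two families above could overlap.
practical-2^ : ∀ k → Practical (2 ^ k)
practical-2^ k = 2^>0 k , λ m _ m≤ →
  let es , es! , es≤k , eq = binary-expansion (suc k) m
        (<-≤-trans (s≤s m≤) (^-monoʳ-< 2 (s≤s (s≤s z≤n)) (n<1+n k)))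
  in map (2 ^_) es , Unique.map⁺ 2^-injective es! ,
     All.map⁺ (All.map (λ { {e} (s≤s e≤k) → 2^>0 e , 2^-monoʳ-∣ e≤k }) es≤k) , eq

practical-odd : ∀ k q → 2 ∤ q → 0 < q → q ≤ 2 ^ suc k → Practical (2 ^ k * q)
practical-odd k q odd q>0 q≤ with q ≟ 1
... | yes refl = subst Practical (sym (*-identityʳ (2 ^ k))) (practical-2^ k)
... | no q≢1 = *-mono-≤ (2^>0 k) q>0 , λ m _ m≤ →
  subst (IsSumOfDistinctDivisors (2 ^ k * q)) (recompose m)
    -- The quotient is at most `2 ^ k` and the remainder is below `q`, so both fit in `suc k` bits.
    (sum-of-divisors k q odd q≢1 q>0 (m / q) (m % q)
      (≤-<-trans (m/q≤ m m≤) (^-monoʳ-< 2 (s≤s (s≤s z≤n)) (n<1+n k)))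
      (<-≤-trans (m%n<n m q) q≤))
  where
  instance
    q≢0 : NonZero q
    q≢0 = >-nonZero q>0
  recompose : ∀ m → q * (m / q) + m % q ≡ m
  recompose m = trans (trans (+-comm _ (m % q)) (cong (m % q +_) (*-comm q (m / q))))
                      (sym (m≡m%n+[m/n]*n m q))
  m/q≤ : ∀ m → m ≤ 2 ^ k * q → m / q ≤ 2 ^ k
  m/q≤ m m≤ = subst (m / q ≤_) (m*n/n≡m (2 ^ k) q) (/-monoˡ-≤ q m≤)

-- Factors 2 of `q` move into the power: halving `q` raises `k`, which only relaxes the bound, until
-- `q` is odd.
practical-2^* : ∀ q k → 0 < q → q ≤ 2 ^ suc k → Practical (2 ^ k * q)
practical-2^* = <-rec _ λ q rec k q>0 q≤ → case q rec k q>0 q≤ (parity-split q)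
  where
  assoc : ∀ x y → 2 * x * y ≡ x * (2 * y)
  assoc = solve-∀
  case : ∀ q → (∀ {p} → p < q → ∀ k → 0 < p → p ≤ 2 ^ suc k → Practical (2 ^ k * p)) →
    ∀ k → 0 < q → q ≤ 2 ^ suc k → (∃[ h ] q ≡ 2 * h) ⊎ (∃[ h ] q ≡ 1 + 2 * h) →
    Practical (2 ^ k * q)
  case _ rec k q>0 q≤ (inj₁ (zero , refl)) = contradiction q>0 λ ()
  case _ rec k q>0 q≤ (inj₁ (h@(suc _) , refl)) =
    subst Practical (assoc (2 ^ k) h)
      (rec (m<m+n h z<s) (suc k) z<s (≤-trans (m≤n*m h 2) (≤-trans q≤ (m≤n*m _ 2))))
  case _ rec k q>0 q≤ (inj₂ (h , refl)) =
    practical-odd k (1 + 2 * h)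
      (λ 2∣q → contradiction (∣m+n∣m⇒∣n (subst (2 ∣_) (+-comm 1 (2 * h)) 2∣q) (m∣m*n h))
        (λ 2∣1 → contradiction (∣⇒≤ 2∣1) λ { (s≤s ()) }))
      q>0 q≤

practical-∣ : ∀ k N → 2 ^ k ∣ N → 0 < N → N ≤ 2 ^ k * (2 * 2 ^ k) → Practical N
practical-∣ k N (divides zero refl) N>0 N≤ = contradiction N>0 λ ()
practical-∣ k N (divides q@(suc _) refl) N>0 N≤ =
  subst Practical (*-comm (2 ^ k) q) (practical-2^* q k z<s
    (*-cancelˡ-≤ (2 ^ k) {{>-nonZero (2^>0 k)}}
      (subst (_≤ 2 ^ k * (2 * 2 ^ k)) (*-comm q (2 ^ k)) N≤)))

-- Roots of the quadratic modulo powers of two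

quad : ℕ → ℕ → ℕ → ℕ
quad b c n = n * (n + b) + c

-- Hensel lifting. With `K = 2 ^ suc k`, moving from `2 * h` to `2 * h + K` adds `K` times an odd
-- number, because `K` is even and the linear coefficient is odd. So when the quotient `t` by `K` is
-- odd, the shift makes the value divisible by `2 * K`.
even-root : ∀ b c k → ∃[ h ] h < 2 ^ k × 2 ^ suc k ∣ quad (1 + 2 * b) (2 * c) (2 * h)
even-root b c zero = 0 , z<s , m∣m*n c
even-root b c (suc k) with even-root b c k
... | h , h< , divides t eq with parity-split t
... | inj₁ (s , refl) =
  h , <-≤-trans h< (m≤n*m (2 ^ k) 2) ,
  divides s (trans eq (regroup s (2 * 2 ^ k)))
  where
  regroup : ∀ s K → 2 * s * K ≡ s * (2 * K)
  regroup = solve-∀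
... | inj₂ (s , refl) =
  h + 2 ^ k , subst (h + 2 ^ k <_) (cong (2 ^ k +_) (sym (+-identityʳ _)))
    (+-monoˡ-< (2 ^ k) h<) ,
  divides (1 + s + 2 * h + 2 ^ k + b)
    (trans (shift h (2 ^ k) b c)
      (trans (cong (_+ 2 * 2 ^ k * (2 * (2 * h) + 2 * 2 ^ k + (1 + 2 * b))) eq)
        (regroup s h (2 ^ k) b)))
  where
  shift : ∀ h κ b c → 2 * (h + κ) * (2 * (h + κ) + (1 + 2 * b)) + 2 * c ≡
    2 * h * (2 * h + (1 + 2 * b)) + 2 * c + 2 * κ * (2 * (2 * h) + 2 * κ + (1 + 2 * b))
  shift = solve-∀
  regroup : ∀ s h κ b →
    (1 + 2 * s) * (2 * κ) + 2 * κ * (2 * (2 * h) + 2 * κ + (1 + 2 * b)) ≡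
    (1 + s + 2 * h + κ + b) * (2 * (2 * κ))
  regroup = solve-∀

-- Modulo `K`, `m` is the other root `- b - n`. The identity `exchange` factors
-- `quad b c n - quad b c m` as `(n - m) * (m + n + b)`, written without subtraction.
reflect-root : ∀ b c K j m n → m + n + b ≡ j * K → K ∣ quad b c n → K ∣ quad b c m
reflect-root b c K j m n eq K∣ =
  ∣m+n∣m⇒∣n
    (subst (K ∣_) (trans (exchange b c m n) (cong (λ x → n * x + quad b c m) eq))
      (∣m∣n⇒∣m+n K∣ (∣n⇒∣m*n m (subst (K ∣_) (sym eq) (∣n⇒∣m*n j ∣-refl)))))
    (∣n⇒∣m*n n (∣n⇒∣m*n j ∣-refl))
  where
  exchange : ∀ b c m n → n * (n + b) + c + m * (m + n + b) ≡ n * (m + n + b) + (m * (m + b) + c)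
  exchange = solve-∀

-- Upper bounds for the quadratic

quad-bound : ∀ b c K n → n < K → n + b ≤ 2 * K → c ≤ 2 * K → quad b c n ≤ K * (2 * K)
quad-bound b c K n n<K n+b≤ c≤ = begin
  n * (n + b) + c        ≤⟨ +-mono-≤ (*-monoʳ-≤ n n+b≤) c≤ ⟩
  n * (2 * K) + 2 * K    ≡⟨ +-comm (n * (2 * K)) (2 * K) ⟩
  suc n * (2 * K)        ≤⟨ *-monoˡ-≤ (2 * K) n<K ⟩
  K * (2 * K)            ∎
  where open ≤-Reasoning

-- Here `n + b` may exceed `2 * K`, but by at most `t`. The resulting excess `n * t` is at most `t`
-- copies of `2 * K`, and `n + t < K` leaves room for them.
quad-bound′ : ∀ c K n t → n + t < K → c ≤ 2 * K →
  quad (K + suc (2 * t)) c n ≤ K * (2 * K)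
quad-bound′ c K n t n+t<K c≤ = begin
  n * (n + (K + suc (2 * t))) + c    ≡⟨ cong (λ x → n * x + c) (regroup n K t) ⟩
  n * (suc (n + t) + K + t) + c      ≤⟨ +-mono-≤ (*-monoʳ-≤ n (+-monoˡ-≤ t (+-monoˡ-≤ K n+t<K))) c≤ ⟩
  n * (K + K + t) + 2 * K            ≡⟨ expand n K t ⟩
  n * t + (n * (2 * K) + 2 * K)      ≤⟨ +-monoˡ-≤ _ (*-monoˡ-≤ t n≤2K) ⟩
  2 * K * t + (n * (2 * K) + 2 * K)  ≡⟨ collect n K t ⟩
  suc (n + t) * (2 * K)              ≤⟨ *-monoˡ-≤ (2 * K) n+t<K ⟩
  K * (2 * K)                        ∎
  where
  open ≤-Reasoning
  regroup : ∀ n K t → n + (K + suc (2 * t)) ≡ suc (n + t) + K + t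
  regroup = solve-∀
  expand : ∀ n K t → n * (K + K + t) + 2 * K ≡ n * t + (n * (2 * K) + 2 * K)
  expand = solve-∀
  collect : ∀ n K t → 2 * K * t + (n * (2 * K) + 2 * K) ≡ suc (n + t) * (2 * K)
  collect = solve-∀
  n≤2K : n ≤ 2 * K
  n≤2K = ≤-trans (m≤m+n n t) (≤-trans (<⇒≤ n+t<K) (m≤n*m K 2))

-- Choice of the root for a given power of two

-- `K` will be the power of two with `K ≤ b ⊔ c < 2 * K`.
Solution : ℕ → ℕ → ℕ → Set
Solution b c K = ∃[ n ] 1 < n × n ≤ K × Practical (quad b c n)

solution-at-root : ∀ k b c n → 0 < c → 1 < n → n < 2 ^ k → 2 ^ k ∣ quad b c n →
  quad b c n ≤ 2 ^ k * (2 * 2 ^ k) → Solution b c (2 ^ k)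
solution-at-root k b c n c>0 n>1 n<K K∣ bound =
  n , n>1 , <⇒≤ n<K , practical-∣ k _ K∣ (≤-trans c>0 (m≤n+m c _)) bound

-- The case c = K, where 0 is a root and the other root is n = j * K - b.
solution-zero-root : ∀ k b j n → j ≤ 2 → n + b ≡ j * 2 ^ suc k → 0 < n → n < 2 ^ suc k →
  Solution b (2 ^ suc k) (2 ^ suc k)
solution-zero-root k b j 1 j≤2 eq _ 1<K =
  -- The root 1 is too small, but then `b + 1 = j * K`, so `n = K` gives the value `K * K * (j + 1)`
  -- with `j + 1 ≤ 3`.
  K , 1<K , ≤-refl ,
  subst Practical
    (trans (cong (_* suc j) (^-distribˡ-+-* 2 (suc k) (suc k))) quad-K)
    (practical-2^* (suc j) (suc k + suc k) z<s
      (≤-trans (s≤s j≤2) (≤-trans (n≤1+n 3)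
        (^-monoʳ-≤ 2 {2} {suc (suc k + suc k)} (s≤s (s≤s z≤n))))))
  where
  K = 2 ^ suc k
  collect : ∀ K j → K * K * suc j ≡ K * K + K * (j * K)
  collect = solve-∀
  expand : ∀ K b → K * K + K * (1 + b) ≡ K * (K + b) + K
  expand = solve-∀
  quad-K : K * K * suc j ≡ quad b K K
  quad-K = trans (collect K j) (trans (cong (λ x → K * K + K * x) (sym eq)) (expand K b))
solution-zero-root k b j n@(suc (suc _)) j≤2 eq _ n<K =
  solution-at-root (suc k) b K n (2^>0 (suc k)) (s≤s (s≤s z≤n)) n<K
    (∣m∣n⇒∣m+n (∣n⇒∣m*n n (divides j eq)) ∣-refl)
    (quad-bound b K K n n<K
      (≤-trans (≤-reflexive eq) (*-monoˡ-≤ K j≤2)) (m≤n*m K 2))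
  where
  K = 2 ^ suc k

odd-above-even : ∀ κ β → 2 * κ ≤ 1 + 2 * β → ∃[ t ] β ≡ κ + t
odd-above-even κ β le with κ ≤? β
... | yes κ≤β with t , eq ← m≤n⇒∃[o]m+o≡n κ≤β = t , sym eq
... | no κ≰β = contradiction le (<⇒≱ (begin-strict
    1 + 2 * β    <⟨ n<1+n _ ⟩
    2 + 2 * β    ≡⟨ *-suc 2 β ⟨
    2 * suc β    ≤⟨ *-monoʳ-≤ 2 (≰⇒> κ≰β) ⟩
    2 * κ        ∎))
  where open ≤-Reasoning

multiple-in-range : ∀ K c → K ∣ c → 0 < c → c < 2 * K → c ≡ K
multiple-in-range K c (divides zero refl) c>0 _ = contradiction c>0 λ ()
multiple-in-range K c (divides 1 refl) _ _ = *-identityˡ K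
multiple-in-range K c (divides (suc (suc q)) refl) _ c<2K =
  contradiction c<2K (≤⇒≯ (*-monoˡ-≤ K (s≤s (s≤s (z≤n {q})))))

-- A nonzero root `2 * h` below `K` satisfies `2 * h + b < 2 * K`, so `quad-bound` applies. If `h`
-- is 0, then `K` divides `c`, which forces `c = K`, and the other root is `K - b`.
solution-small-b : ∀ k b c h → 0 < b → 0 < c → b < 2 ^ suc k → c < 2 * 2 ^ suc k → h < 2 ^ k →
  2 ^ suc k ∣ quad b c (2 * h) → Solution b c (2 ^ suc k)
solution-small-b k b c zero b>0 c>0 b<K c<2K _ K∣
  rewrite multiple-in-range (2 ^ suc k) c K∣ c>0 c<2K
  with n , eq ← m≤n⇒∃[o]m+o≡n (<⇒≤ b<K) =
  solution-zero-root k b 1 n (s≤s z≤n)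
    (trans (+-comm n b) (trans eq (sym (*-identityˡ _))))
    (+-cancelˡ-< b 0 n (subst₂ _<_ (sym (+-identityʳ b)) (sym eq) b<K))
    (subst (n <_) eq (m<n+m n b>0))
solution-small-b k b c h@(suc _) b>0 c>0 b<K c<2K h<κ K∣ =
  solution-at-root (suc k) b c (2 * h) c>0 (*-monoʳ-≤ 2 (s≤s z≤n)) 2h<K K∣
    (quad-bound b c (2 ^ suc k) (2 * h) 2h<K
      (≤-trans (+-mono-≤ (<⇒≤ 2h<K) (<⇒≤ b<K)) (≤-reflexive (cong (2 ^ suc k +_) (sym (+-identityʳ _)))))
      (<⇒≤ c<2K))
  where
  2h<K = *-monoʳ-< 2 h<κ

-- For nonzero `h` the roots `2 * h` and `3 * K - b - 2 * h` add up to `2 * K - 2 * t - 1`. Adding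
-- `t` to each gives the total `2 * K - 1`, so one of them satisfies the hypothesis `n + t < K` of
-- `quad-bound′`.
solution-large-b : ∀ k t c h → 0 < c → t < 2 ^ k → c < 2 * 2 ^ suc k → h < 2 ^ k →
  2 ^ suc k ∣ quad (2 ^ suc k + suc (2 * t)) c (2 * h) →
  Solution (2 ^ suc k + suc (2 * t)) c (2 ^ suc k)
solution-large-b k t c zero c>0 t<κ c<2K _ K∣
  rewrite multiple-in-range (2 ^ suc k) c K∣ c>0 c<2K
  with u , eq ← m≤n⇒∃[o]m+o≡n t<κ =
  -- Since `suc t + u = 2 ^ k`, the other root `2 * K - b` is `1 + 2 * u`.
  solution-zero-root k (2 ^ suc k + suc (2 * t)) 2 (1 + 2 * u) ≤-refl
    (subst (λ κ → 1 + 2 * u + (2 * κ + suc (2 * t)) ≡ 2 * (2 * κ)) eq (sum≡ t u))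
    z<s
    (subst (λ κ → 1 + 2 * u < 2 * κ) eq
      (subst (2 + 2 * u ≤_) (sym (double t u)) (m≤n+m _ (2 * t))))
  where
  sum≡ : ∀ t u → 1 + 2 * u + (2 * (suc t + u) + suc (2 * t)) ≡ 2 * (2 * (suc t + u))
  sum≡ = solve-∀
  double : ∀ t u → 2 * (suc t + u) ≡ 2 * t + (2 + 2 * u)
  double = solve-∀
solution-large-b k t c h@(suc _) c>0 t<κ c<2K h<κ K∣ with 2 * h + t <? 2 ^ suc k
... | yes 2h+t<K =
  solution-at-root (suc k) _ c (2 * h) c>0 (*-monoʳ-≤ 2 (s≤s z≤n)) (*-monoʳ-< 2 h<κ) K∣
    (quad-bound′ c (2 ^ suc k) (2 * h) t 2h+t<K (<⇒≤ c<2K))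
... | no 2h+t≮K
  with u , t+u ← m≤n⇒∃[o]m+o≡n t<κ
  with v , h+v ← m≤n⇒∃[o]m+o≡n h<κ =
  solution-at-root (suc k) _ c n c>0 (s≤s (s≤s z≤n)) (≤-<-trans (m≤m+n n t) n+t<K)
    (reflect-root _ c K 3 n (2 * h) n+2h+b K∣)
    (quad-bound′ c K n t n+t<K (<⇒≤ c<2K))
  where
  K = 2 ^ suc k
  -- This is `3 * K - b - 2 * h`, rewritten with `2 ^ k = suc t + u = suc h + v`; it visibly exceeds
  -- 1.
  n = 3 + 2 * u + 2 * v
  four-κ : n + t + 1 + (2 * h + t) ≡ K + K
  four-κ = trans (identity t u h v) (cong₂ (λ x y → 2 * x + 2 * y) t+u h+v)
    where
    identity : ∀ t u h v → 3 + 2 * u + 2 * v + t + 1 + (2 * h + t) ≡ 2 * (suc t + u) + 2 * (suc h + v)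
    identity = solve-∀
  n+2h+b : n + 2 * h + (K + suc (2 * t)) ≡ 3 * K
  n+2h+b = trans (left n t h K) (trans (cong (K +_) four-κ) (right K))
    where
    left : ∀ n t h K → n + 2 * h + (K + suc (2 * t)) ≡ K + (n + t + 1 + (2 * h + t))
    left = solve-∀
    right : ∀ K → K + (K + K) ≡ 3 * K
    right = solve-∀
  n+t<K : n + t < K
  n+t<K = +-cancelʳ-≤ K _ _ (begin
    suc (n + t) + K                ≤⟨ +-monoʳ-≤ _ (≮⇒≥ 2h+t≮K) ⟩
    suc (n + t) + (2 * h + t)      ≡⟨ cong (_+ (2 * h + t)) (+-comm 1 (n + t)) ⟩
    n + t + 1 + (2 * h + t)        ≡⟨ four-κ ⟩
    K + K                          ∎)
    where open ≤-Reasoning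

solution-in-dyadic-range : ∀ k β γ → 0 < γ → 1 + 2 * β < 2 * 2 ^ suc k → 2 * γ < 2 * 2 ^ suc k →
  Solution (1 + 2 * β) (2 * γ) (2 ^ suc k)
solution-in-dyadic-range k β γ γ>0 b<2K c<2K with even-root β γ k | 1 + 2 * β <? 2 ^ suc k
... | h , h<κ , K∣ | yes b<K =
  solution-small-b k _ _ h z<s (*-mono-≤ (s≤s (z≤n {1})) γ>0) b<K c<2K h<κ K∣
... | h , h<κ , K∣ | no b≮K
  -- `K` is even and `b` odd, so `b ≥ K` gives `b = K + 2 * t + 1`, and `b < 2 * K` becomes
  -- `t < 2 ^ k`.
  with t , refl ← odd-above-even (2 ^ k) β (≮⇒≥ b≮K) =
  subst (λ b → Solution b (2 * γ) (2 ^ suc k)) (regroup (2 ^ k) t)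
    (solution-large-b k t (2 * γ) h (*-mono-≤ (s≤s (z≤n {1})) γ>0) t<κ c<2K h<κ
      (subst (λ b → 2 ^ suc k ∣ quad b (2 * γ) (2 * h)) (sym (regroup (2 ^ k) t)) K∣))
  where
  regroup : ∀ κ t → 2 * κ + suc (2 * t) ≡ 1 + 2 * (κ + t)
  regroup = solve-∀
  t<κ : t < 2 ^ k
  t<κ = +-cancelˡ-< (2 ^ k) t (2 ^ k)
    (subst (2 ^ k + t <_) (cong (2 ^ k +_) (+-identityʳ (2 ^ k)))
      (*-cancelˡ-< 2 (2 ^ k + t) (2 ^ suc k) (<-trans (n<1+n _) b<2K)))

-- The dyadic range of `b ⊔ c`

dyadic-range : ∀ m → ∃[ k ] 2 ^ suc k ≤ 2 + m × 2 + m < 2 * 2 ^ suc k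
dyadic-range zero = 0 , ≤-refl , s≤s (s≤s (s≤s z≤n))
dyadic-range (suc m) with dyadic-range m
... | k , lo , hi with 3 + m <? 2 * 2 ^ suc k
... | yes lt = k , m≤n⇒m≤1+n lo , lt
... | no ≮ = suc k , ≮⇒≥ ≮ ,
  ≤-<-trans hi (^-monoʳ-< 2 (s≤s (s≤s z≤n)) (n<1+n (2 + k)))

theorem1 : (b c : ℕ) → 0 < b → 0 < c → 2 ∤ b → 2 ∣ c →
    ∃[ n ] 1 < n × n ≤ b ⊔ c × Practical (n ^ 2 + b * n + c)
theorem1 b c b>0 c>0 2∤b (divides zero refl) = contradiction c>0 λ ()
theorem1 b c b>0 c>0 2∤b (divides γ@(suc γ′) refl)
  with β , refl ← odd⇒1+2* b 2∤b
  -- A positive even `c` makes the maximum at least 2, so the power of two taken below it can have a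
  -- positive exponent `suc k`.
  with m , 2+m ← m≤n⇒∃[o]m+o≡n (≤-trans (s≤s (s≤s (z≤n {γ′ * 2}))) (m≤n⊔m b (γ * 2)))
  with k , lo , hi ← dyadic-range m
  with n , n>1 , n≤K , practical ← solution-in-dyadic-range k β γ z<s
    (≤-<-trans (m≤m⊔n b (γ * 2)) (subst (_< 2 * 2 ^ suc k) 2+m hi))
    (≤-<-trans (≤-trans (≤-reflexive (*-comm 2 γ)) (m≤n⊔m b (γ * 2)))
      (subst (_< 2 * 2 ^ suc k) 2+m hi)) =
  n , n>1 , ≤-trans n≤K (≤-trans lo (≤-reflexive 2+m)) ,
  subst Practical (expand n β γ) practical
  where
  expand : ∀ n β γ → n * (n + (1 + 2 * β)) + 2 * γ ≡ n * (n * 1) + (1 + 2 * β) * n + γ * 2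
  expand = solve-∀
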